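{- Let $\langle\mathcal{D},\mathcal{S},\mathcal{R}\rangle$ be a DT problem. Then (a) for all $t^\sharp\in\mathcal{T}^\sharp$ with $t\in\mathcal{T}^{\mathcal{R}}_{\mathrm{basic}}$, we have $$\mathit{Cplx}_{\langle\mathcal{D},\mathcal{S},\mathcal{R}\rangle}(t^\sharp)\;\leq\;\mathrm{dh}\bigl(t^\sharp,\xrightarrow{\mathsf{i}}_{\mathcal{S}/((\mathcal{D}\setminus\mathcal{S})\cup\mathcal{R})}\bigr);$$ (b) for all $n\in\mathbb{N}$, $\ \mathrm{irc}_{\langle\mathcal{D},\mathcal{S},\mathcal{R}\rangle}(n)\;\leq\;\mathrm{irc}_{\mathcal{S}/((\mathcal{D}\setminus\mathcal{S})\cup\mathcal{R})}(n)$.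
   Context: Terms and rewriting. $\mathcal{T}(\Sigma,\mathcal{V})$ is the set of first-order terms over a finite signature $\Sigma$ and variables $\mathcal{V}$. The size of a term is $|x|=1$ for $x\in\mathcal{V}$ and $|f(t_1,\ldots,t_n)|=1+\sum_i|t_i|$. $t|_\pi$ is the subterm of $t$ at position $\pi$, $t[s]_\pi$ is $t$ with that subterm replaced by $s$. A term rewrite system (TRS) $\mathcal{R}$ is a finite set of rules $\ell \to r$ with $\ell,r$ terms, $\ell \notin \mathcal{V}$ and $\mathcal{V}(r) \subseteq \mathcal{V}(\ell)$ (where $\mathcal{V}(t)$ is the set of variables of $t$). $s \to_{\mathcal{R}} t$ iff $s|_\pi = \ell\sigma$ and $t = s[r\sigma]_\pi$ for some $\ell\to r\in\mathcal{R}$, position $\pi$ of $s$ and substitution $\sigma$; $\ell\sigma$ is the redex. It is an innermost redex if no proper subterm of it is a redex, and then the step is an innermost step, written $s \xrightarrow{\mathsf{i}}_{\mathcal{R}} t$. For a TRS $\mathcal{R}$ over $\Sigma$, the defined symbols are $\Sigma_d^{\mathcal{R}}=\{f \mid f(\ell_1,\ldots,\ell_n)\to r\in\mathcal{R}\}$ and the constructor symbols are $\Sigma_c^{\mathcal{R}}=\Sigma\setminus\Sigma_d^{\mathcal{R}}$. $\mathcal{T}^{\mathcal{R}}_{\mathrm{basic}}$ is the set of basic terms, i.e., terms $f(t_1,\ldots,t_k)$ with $f \in\Sigma_d^{\mathcal{R}}$ and all $t_i\in\mathcal{T}(\Sigma_c^{\mathcal{R}},\mathcal{V})$. Derivation height: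 $\mathrm{dh}(t,\to)=\sup\{e \mid \exists t'.\ t\to^e t'\}\in\mathbb{N}\cup\{\omega\}$, with value $\omega$ if $t$ starts an infinite $\to$-sequence; $\sup$ is the least upper bound in $\mathbb{N}\cup\{\omega\}$, $\sup\emptyset=0$. Relative rewriting: for TRSs $\mathcal{R}_1,\mathcal{R}_2$, $\mathcal{R}_1/\mathcal{R}_2$ is a relative TRS, and $s\xrightarrow{\mathsf{i}}_{\mathcal{R}_1/\mathcal{R}_2}t$ iff $s\to^*_{\mathcal{R}_2}s'\to_{\mathcal{R}_1}s''\to^*_{\mathcal{R}_2}t$ for some $s',s''$ such that the proper subterms of the redexes of each of these $\to_{\mathcal{R}_1}$- and $\to_{\mathcal{R}_2}$-steps are in normal form w.r.t. $\mathcal{R}_1\cup\mathcal{R}_2$. Its basic terms are $\mathcal{T}^{\mathcal{R}_1/\mathcal{R}_2}_{\mathrm{basic}}=\mathcal{T}^{\mathcal{R}_1\cup\mathcal{R}_2}_{\mathrm{basic}}$, and $\mathrm{irc}_{\mathcal{R}_1/\mathcal{R}_2}(n)=\sup\{\mathrm{dh}(t,\xrightarrow{\mathsf{i}}_{\mathcal{R}_1/\mathcal{R}_2})\mid t\in\mathcal{T}^{\mathcal{R}_1/\mathcal{R}_2}_{\mathrm{basic}},\ |t|\le n\}$. Sharp terms: for every $f\in\Sigma_d=\Sigma_d^{\mathcal{R}}$ introduce a fresh symbol $f^\sharp$ of the same arity. For $t=f(t_1,\ldots,t_n)$ with $f\in\Sigma_d$, $t^\sharp=f^\sharp(t_1,\ldots,t_n)$;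 for all other terms $t^\sharp=t$. $\mathcal{T}^\sharp=\{t^\sharp\mid t\in\mathcal{T}(\Sigma,\mathcal{V}),\ \mathrm{root}(t)\in\Sigma_d\}$. For each $n$ let $\mathsf{Com}_n$ be a fresh "compound" symbol of arity $n$. A dependency tuple (DT) is a rule $s^\sharp\to\mathsf{Com}_n(t_1^\sharp,\ldots,t_n^\sharp)$ with $s^\sharp,t_1^\sharp,\ldots,t_n^\sharp\in\mathcal{T}^\sharp$. A DT problem is a triple $\langle\mathcal{D},\mathcal{S},\mathcal{R}\rangle$ with $\mathcal{R}$ a TRS over $\Sigma$, $\mathcal{D}$ a finite set of DTs and $\mathcal{S}\subseteq\mathcal{D}$. The relative TRS corresponding to it is $\mathcal{S}/((\mathcal{D}\setminus\mathcal{S})\cup\mathcal{R})$, over the signature $\Sigma$ extended by the sharp symbols and the compound symbols. Chain trees: let $T$ be a (possibly infinite) tree whose nodes are labelled with pairs $(q^\sharp\to\mathsf{Com}_n(w_1^\sharp,\ldots,w_n^\sharp)\mid\nu)$ of a DT from $\mathcal{D}$ and a substitution $\nu$, with root label $(s^\sharp\to\mathsf{Com}_e(\ldots)\mid\sigma)$. $T$ is a $(\mathcal{D},\mathcal{R})$-chain tree for $s^\sharp\sigma$ iff for every node, with label $(u^\sharp\to\mathsf{Com}_m(v_1^\sharp,\ldots,v_m^\sharp)\mid\mu)$: (i) $u^\sharp\mu$ is in normal form w.r.t. $\mathcal{R}$; (ii) if its children are labelled $(p_1^\sharp\to\mathsf{Com}_{m_1}(\ldots)\mid\delta_1),\ldots,(p_k^\sharp\to\mathsf{Com}_{m_k}(\ldots)\mid\delta_k)$,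 then there are pairwise different $i_1,\ldots,i_k\in\{1,\ldots,m\}$ with $v_{i_j}^\sharp\mu\xrightarrow{\mathsf{i}}{}^{*}_{\mathcal{R}}p_j^\sharp\delta_j$ for all $j\in\{1,\ldots,k\}$. Complexity of DT problems: $|T|_{\mathcal{S}}\in\mathbb{N}\cup\{\omega\}$ is the number of nodes of $T$ labelled with a DT from $\mathcal{S}$, and $\mathit{Cplx}_{\langle\mathcal{D},\mathcal{S},\mathcal{R}\rangle}(s^\sharp)=\sup\{|T|_{\mathcal{S}}\mid T\text{ is a }(\mathcal{D},\mathcal{R})\text{ -chain tree for }s^\sharp\}$; it is $0$ for terms $s^\sharp$ that have no chain tree. $\mathrm{irc}_{\langle\mathcal{D},\mathcal{S},\mathcal{R}\rangle}(n)=\sup\{\mathit{Cplx}_{\langle\mathcal{D},\mathcal{S},\mathcal{R}\rangle}(t^\sharp)\mid t\in\mathcal{T}^{\mathcal{R}}_{\mathrm{basic}},\ |t|\le n\}$. -}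

module Defs where

open import Axiom.ExcludedMiddle using (ExcludedMiddle)
open import Data.Empty using (⊥-elim)
open import Data.Fin using (Fin; toℕ)
import Data.Fin.Properties as Fin
open import Data.List using (List; []; _∷_; map)
open import Data.List.Membership.Propositional using (_∈_; find; lose)
open import Data.List.Relation.Binary.Subset.Propositional using (_⊆_)
open import Data.List.Relation.Unary.All using (All)
open import Data.List.Relation.Unary.Any using (any?)
open import Data.Maybe using (Maybe; just; nothing)
open import Data.Maybe.Properties using (≡-dec)
open import Data.Nat using (ℕ; zero; suc; _+_; _≤_; _<_; z≤n)
open import Data.Nat.Properties using (≤-trans; ≤-refl; ≮⇒≥)
open import Data.Product using (∃; ∃-syntax; _×_; _,_; proj₁; proj₂)
open import Data.Sum using (_⊎_; inj₁; inj₂)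
open import Data.Unit using (⊤)
open import Data.Vec as Vec using (Vec; []; _∷_; lookup; _[_]≔_)
import Data.Vec.Relation.Unary.All as VecAll
open import Function.Definitions using (Injective)
open import Level using (0ℓ)
open import Relation.Binary using (Rel)
open import Relation.Binary.Construct.Closure.ReflexiveTransitive using (Star)
open import Relation.Binary.PropositionalEquality using (_≡_; _≢_; refl)
open import Relation.Nullary using (¬_; Dec; yes; no)
open import Relation.Nullary.Decidable using (map′)
open import Relation.Unary using (Pred; _∪_; _∖_)

----------------------------------------------------------------------
-- ℕ ∪ {ω}
--
-- A supremum of a set of naturals cannot be computed as a datum of an
-- inductive type with constructors for n and ω.  An element x of ℕ ∪ {ω}
-- is therefore given by the set { k ∈ ℕ | k ≤ x }.  By `classify`, under
-- excluded middle every x is a natural number or ω.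

record ℕω : Set₁ where
  field
    Below      : ℕ → Set
    zero-below : Below 0
    down       : ∀ {k l} → k ≤ l → Below l → Below k

open ℕω public

infix 4 _≤ω_

_≤ω_ : ℕω → ℕω → Set
x ≤ω y = ∀ k → Below x k → Below y k

fin : ℕ → ℕω
fin n = record { Below = _≤ n ; zero-below = z≤n ; down = ≤-trans }

ω : ℕω
ω = record { Below = λ _ → ⊤ ; zero-below = _ ; down = λ _ _ → _ }

-- The first disjunct makes the supremum of the empty family 0.
sup : {I : Set} → (I → ℕω) → ℕω
sup {I} a = record
  { Below      = λ k → k ≡ 0 ⊎ ∃[ i ] Below (a i) k
  ; zero-below = inj₁ refl
  ; down       = λ where
      z≤n (inj₁ refl)    → inj₁ refl
      k≤l (inj₂ (i , b)) → inj₂ (i , down (a i) k≤l b)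
  }

sup-upper : {I : Set} (a : I → ℕω) → ∀ i → a i ≤ω sup a
sup-upper a i k b = inj₂ (i , b)

sup-least : {I : Set} (a : I → ℕω) (x : ℕω) → (∀ i → a i ≤ω x) → sup a ≤ω x
sup-least a x ub k (inj₁ refl)    = zero-below x
sup-least a x ub k (inj₂ (i , b)) = ub i k b

classify : ExcludedMiddle 0ℓ →
           ∀ x → (ω ≤ω x) ⊎ (∃[ n ] (x ≤ω fin n × fin n ≤ω x))
classify em x with em {∃[ k ] ¬ Below x k}
... | yes (k , ¬b) = inj₂ (largest k ¬b)
  where
  largest : ∀ k → ¬ Below x k → ∃[ n ] (x ≤ω fin n × fin n ≤ω x)
  largest zero    ¬b = ⊥-elim (¬b (zero-below x))
  largest (suc k) ¬b with em {Below x k}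
  ... | yes b  = k , (λ l bl → ≮⇒≥ (λ k<l → ¬b (down x k<l bl)))
                   , (λ l l≤k → down x l≤k b)
  ... | no ¬b′ = largest k ¬b′
... | no all = inj₁ (λ k _ → below k)
  where
  below : ∀ k → Below x k
  below k with em {Below x k}
  ... | yes b = b
  ... | no ¬b = ⊥-elim (all (k , ¬b))

card : {X : Set} → Pred X 0ℓ → ℕω
card {X} A =
  sup {I = ∃[ k ] ∃[ e ] (Injective {A = Fin k} {B = X} _≡_ _≡_ e × ∀ i → A (e i))}
      (λ (k , _) → fin k)

----------------------------------------------------------------------
-- Derivation height

Pow : {X : Set} → Rel X 0ℓ → ℕ → Rel X 0ℓ
Pow _⟶_ zero    s t = s ≡ t
Pow _⟶_ (suc e) s t = ∃[ u ] (s ⟶ u × Pow _⟶_ e u t)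

dh : {X : Set} → X → Rel X 0ℓ → ℕω
dh t _⟶_ = sup {I = ∃[ e ] ∃[ t′ ] Pow _⟶_ e t t′} (λ (e , _) → fin e)

dh-infinite : {X : Set} (_⟶_ : Rel X 0ℓ) (s : ℕ → X) →
              (∀ i → s i ⟶ s (suc i)) → ω ≤ω dh (s 0) _⟶_
dh-infinite _⟶_ s step k _ =
  inj₂ ((k , go s step k) , ≤-refl)
  where
  go : ∀ s → (∀ i → s i ⟶ s (suc i)) → ∀ k → ∃[ t′ ] Pow _⟶_ k (s 0) t′
  go s step zero    = s 0 , refl
  go s step (suc k) =
    let t′ , d = go (λ i → s (suc i)) (λ i → step (suc i)) k
    in  t′ , s 1 , step 0 , d

----------------------------------------------------------------------
-- Terms

-- Not necessarily finite, because there is one compound symbol per arity.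
record Signature : Set₁ where
  field
    Sym   : Set
    arity : Sym → ℕ

open Signature public

record FinSignature : Set where
  field
    size     : ℕ
    arityFin : Fin size → ℕ

  sig : Signature
  sig = record { Sym = Fin size ; arity = arityFin }

open FinSignature public using (sig)

Var : Set
Var = ℕ

data Term (Σ : Signature) : Set where
  var : Var → Term Σ
  fun : (f : Sym Σ) → Vec (Term Σ) (arity Σ f) → Term Σ

private
  variable
    Σ : Signature
    n : ℕ

∣_∣ : Term Σ → ℕ
∣_∣* : Vec (Term Σ) n → ℕ
∣ var x ∣    = 1
∣ fun f ts ∣ = suc ∣ ts ∣*
∣ [] ∣*      = 0
∣ t ∷ ts ∣*  = ∣ t ∣ + ∣ ts ∣*

root : Term Σ → Maybe (Sym Σ)
root (var x)    = nothing
root (fun f ts) = just f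

data _∈V_ {Σ : Signature} (x : Var) : Term Σ → Set where
  here  : x ∈V var x
  there : ∀ {f ts} (i : Fin (arity Σ f)) → x ∈V lookup ts i → x ∈V fun f ts

Subst : Signature → Set
Subst Σ = Var → Term Σ

infixl 30 _·_ _·*_

_·_ : Term Σ → Subst Σ → Term Σ
_·*_ : Vec (Term Σ) n → Subst Σ → Vec (Term Σ) n
var x    · σ    = σ x
fun f ts · σ    = fun f (ts ·* σ)
[]       ·* σ   = []
(t ∷ ts) ·* σ   = t · σ ∷ ts ·* σ

data Pos {Σ : Signature} : Term Σ → Set where
  here  : ∀ {t} → Pos t
  there : ∀ {f ts} (i : Fin (arity Σ f)) → Pos (lookup ts i) → Pos (fun f ts)

_∣at_ : (t : Term Σ) → Pos t → Term Σ
t        ∣at here      = t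
fun f ts ∣at there i π = lookup ts i ∣at π

_[_]at_ : (t : Term Σ) → Term Σ → Pos t → Term Σ
t        [ s ]at here      = s
fun f ts [ s ]at there i π = fun f (ts [ i ]≔ (lookup ts i [ s ]at π))

_ProperSubtermOf_ : Term Σ → Term Σ → Set
u ProperSubtermOf t = ∃[ π ] (π ≢ here × u ≡ t ∣at π)

----------------------------------------------------------------------
-- Rewriting

record Rule (Σ : Signature) : Set where
  constructor _⇒_
  field
    lhs rhs : Term Σ

open Rule public

IsRule : Rule Σ → Set
IsRule ρ = (∀ x → lhs ρ ≢ var x) × (∀ x → x ∈V rhs ρ → x ∈V lhs ρ)

RuleSet : Signature → Set₁
RuleSet Σ = Pred (Rule Σ) 0ℓ

record TRS (F : FinSignature) : Set where
  field
    rules   : List (Rule (sig F))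
    isRules : All IsRule rules

open TRS public

⟦_⟧ : ∀ {F} → TRS F → RuleSet (sig F)
⟦ R ⟧ ρ = ρ ∈ rules R

-- A rewrite step with rules from P whose redex satisfies C.
record Step (C : Term Σ → Set) (P : RuleSet Σ) (s t : Term Σ) : Set where
  field
    π       : Pos s
    ρ       : Rule Σ
    ρ∈P     : P ρ
    σ       : Subst Σ
    redex   : s ∣at π ≡ lhs ρ · σ
    allowed : C (lhs ρ · σ)
    result  : t ≡ s [ rhs ρ · σ ]at π

IsRedex : RuleSet Σ → Term Σ → Set
IsRedex P t = ∃[ ρ ] ∃[ σ ] (P ρ × t ≡ lhs ρ · σ)

_⊢_⟶_ : RuleSet Σ → Rel (Term Σ) 0ℓ
P ⊢ s ⟶ t = Step (λ _ → ⊤) P s t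

NF : RuleSet Σ → Term Σ → Set
NF P t = ¬ (∃[ t′ ] (P ⊢ t ⟶ t′))

_⊢_⟶ⁱ_ : RuleSet Σ → Rel (Term Σ) 0ℓ
P ⊢ s ⟶ⁱ t = Step (λ u → ∀ v → v ProperSubtermOf u → ¬ IsRedex P v) P s t

_⊢_⟶ⁱ*_ : RuleSet Σ → Rel (Term Σ) 0ℓ
P ⊢ s ⟶ⁱ* t = Star (P ⊢_⟶ⁱ_) s t

Defined : RuleSet Σ → Sym Σ → Set
Defined P f = ∃[ ρ ] (P ρ × root (lhs ρ) ≡ just f)

data ConstructorTerm (P : RuleSet Σ) : Term Σ → Set where
  var : ∀ x → ConstructorTerm P (var x)
  fun : ∀ {f ts} → ¬ Defined P f → (∀ i → ConstructorTerm P (lookup ts i)) →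
        ConstructorTerm P (fun f ts)

data Basic (P : RuleSet Σ) : Term Σ → Set where
  basic : ∀ {f ts} → Defined P f → (∀ i → ConstructorTerm P (lookup ts i)) →
          Basic P (fun f ts)

-- The innermost relation of the relative system P₁/P₂.
module Relative {Σ : Signature} (P₁ P₂ : RuleSet Σ) where

  InnermostStep : RuleSet Σ → Rel (Term Σ) 0ℓ
  InnermostStep =
    Step (λ u → ∀ v → v ProperSubtermOf u → NF (P₁ ∪ P₂) v)

  _⟶ⁱ/_ : Rel (Term Σ) 0ℓ
  s ⟶ⁱ/ t = ∃[ s′ ] ∃[ s″ ] (Star (InnermostStep P₂) s s′
                             × InnermostStep P₁ s′ s″
                             × Star (InnermostStep P₂) s″ t)

relativeStep : RuleSet Σ → RuleSet Σ → Rel (Term Σ) 0ℓ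
relativeStep P₁ P₂ = Relative._⟶ⁱ/_ P₁ P₂

ircRelative : RuleSet Σ → RuleSet Σ → ℕ → ℕω
ircRelative P₁ P₂ n =
  sup {I = ∃[ t ] (Basic (P₁ ∪ P₂) t × ∣ t ∣ ≤ n)}
      (λ (t , _) → dh t (relativeStep P₁ P₂))

----------------------------------------------------------------------
-- Sharp terms and dependency tuples

-- A node is a path to the root: child number i of node p is i ∷ p.
-- Values of `label` and `#children` at paths that are not nodes are irrelevant.
record Tree (L : Set) : Set where
  field
    #children : List ℕ → ℕ
    label     : List ℕ → L

  data Node : List ℕ → Set where
    top   : Node []
    child : ∀ {p} → Node p → (i : Fin (#children p)) → Node (toℕ i ∷ p)

module Sharp {F : FinSignature} (R : TRS F) where

  defined? : ∀ f → Dec (Defined ⟦ R ⟧ f)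
  defined? f = map′ find (λ (_ , ρ∈R , eq) → lose ρ∈R eq)
                    (any? (λ ρ → ≡-dec Fin._≟_ (root (lhs ρ)) (just f)) (rules R))

  -- The proof is irrelevant, so there is exactly one f♯ per defined f.
  data Sym♯ : Set where
    base  : Sym (sig F) → Sym♯
    sharp : (f : Sym (sig F)) → .(Defined ⟦ R ⟧ f) → Sym♯
    com   : ℕ → Sym♯

  arity♯ : Sym♯ → ℕ
  arity♯ (base f)    = arity (sig F) f
  arity♯ (sharp f _) = arity (sig F) f
  arity♯ (com n)     = n

  Σ♯ : Signature
  Σ♯ = record { Sym = Sym♯ ; arity = arity♯ }

  embed : Term (sig F) → Term Σ♯
  embed* : ∀ {n} → Vec (Term (sig F)) n → Vec (Term Σ♯) n
  embed (var x)    = var x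
  embed (fun f ts) = fun (base f) (embed* ts)
  embed* []        = []
  embed* (t ∷ ts)  = embed t ∷ embed* ts

  embedRule : Rule (sig F) → Rule Σ♯
  embedRule (l ⇒ r) = embed l ⇒ embed r

  -- R as a set of rules over the extended signature.
  R♯ : RuleSet Σ♯
  R♯ ρ = ρ ∈ map embedRule (rules R)

  _♯ : Term (sig F) → Term Σ♯
  (var x) ♯ = var x
  (fun f ts) ♯ with defined? f
  ... | yes d = fun (sharp f d) (embed* ts)
  ... | no _  = fun (base f) (embed* ts)

  RootDefined : Term (sig F) → Set
  RootDefined t = ∃[ f ] (root t ≡ just f × Defined ⟦ R ⟧ f)

  -- Stands for the rule  source ♯ → Com_width (targets ♯).
  record DT : Set where
    field
      source  : Term (sig F)
      width   : ℕ
      targets : Vec (Term (sig F)) width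

    source♯ : Term Σ♯
    source♯ = source ♯

    target♯ : Fin width → Term Σ♯
    target♯ i = lookup targets i ♯

    rule : Rule Σ♯
    rule = source♯ ⇒ fun (com width) (Vec.map _♯ targets)

  open DT public

  IsDT : DT → Set
  IsDT d = RootDefined (source d) × VecAll.All RootDefined (targets d) × IsRule (rule d)

  ⟦_⟧ᴰ : List DT → RuleSet Σ♯
  ⟦ D ⟧ᴰ ρ = ρ ∈ map rule D

record DTProblem (F : FinSignature) : Set where
  field
    R     : TRS F
    D     : List (Sharp.DT R)
    isDTs : All (Sharp.IsDT R) D
    S     : List (Sharp.DT R)
    S⊆D   : S ⊆ D

----------------------------------------------------------------------
-- Chain trees and complexity

module Problem {F : FinSignature} (P : DTProblem F) where

  open DTProblem P public
  open Sharp R public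

  -- The second component of the relative system S/((D∖S) ∪ R).
  weak : RuleSet Σ♯
  weak = (⟦ D ⟧ᴰ ∖ ⟦ S ⟧ᴰ) ∪ R♯

  Label : Set
  Label = DT × Subst Σ♯

  module _ (T : Tree Label) where
    open Tree T

    dt : List ℕ → DT
    dt p = proj₁ (label p)

    sub : List ℕ → Subst Σ♯
    sub p = proj₂ (label p)

    record IsChainTreeFor (s : Term Σ♯) : Set where
      field
        start    : source♯ (dt []) · sub [] ≡ s
        labels   : ∀ {p} → Node p → dt p ∈ D
        normal   : ∀ {p} → Node p → NF R♯ (source♯ (dt p) · sub p)
        children : ∀ {p} → Node p →
          ∃[ ι ] (Injective {A = Fin (#children p)} {B = Fin (width (dt p))} _≡_ _≡_ ι
                  × ∀ j → R♯ ⊢ target♯ (dt p) (ι j) · sub p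
                             ⟶ⁱ* source♯ (dt (toℕ j ∷ p)) · sub (toℕ j ∷ p))

    sizeS : ℕω
    sizeS = card (λ p → Node p × dt p ∈ S)

  Cplx : Term Σ♯ → ℕω
  Cplx s = sup {I = ∃[ T ] IsChainTreeFor T s} (λ (T , _) → sizeS T)

  ircDT : ℕ → ℕω
  ircDT n = sup {I = ∃[ t ] (Basic ⟦ R ⟧ t × ∣ t ∣ ≤ n)} (λ (t , _) → Cplx (t ♯))

{-# OPTIONS --safe #-}

-- Along a chain tree for t♯ every node carries a term whose root is sharp and
-- whose other symbols all come from Σ.  In such a term DT rules apply only at
-- the root and R only below it, so that a term in normal form for R has
-- only subterms in normal form for D ∪ R below the root.  Hence a chain tree
-- cut off at any finite depth can be replayed as an innermost derivation in
-- which the compound symbols keep the children apart, with one DT step per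
-- node.  Any k distinct S-nodes lie above some finite depth, which gives
-- a derivation with at least k steps by S.
module Submission where

open import Defs
open import Data.Fin as Fin using (Fin; toℕ; zero; suc)
import Data.Fin.Properties as Fin
open import Data.List as List using (List; []; _∷_; map; length; filter; concat; tabulate)
open import Data.List.Membership.Propositional using (_∈_)
open import Data.List.Membership.Propositional.Properties
  using (∈-map⁺; ∈-map⁻; ∈-concat⁺′; ∈-concat⁻′; ∈-tabulate⁺; ∈-tabulate⁻; ∈-filter⁺)
open import Data.List.Properties using (filter-++; length-++)
import Data.List.Relation.Unary.All as All
open import Data.List.Relation.Unary.Any using (here; there; any?)
open import Data.List.Relation.Unary.Any.Properties using (lookup-index)
open import Data.Maybe using (just)
open import Data.Nat using (ℕ; zero; suc; _+_; _≤_; _<_; s≤s; _⊔_)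
open import Data.Nat.ListAction using (sum)
open import Data.Nat.Properties as ℕ
  using (≤-trans; ≤-reflexive; m≤m⊔n; m≤n⊔m)
open import Data.Product using (∃-syntax; _×_; _,_; proj₁; proj₂)
open import Data.Sum using (_⊎_; inj₁; inj₂)
open import Data.Vec as Vec using (Vec; []; _∷_; lookup; _[_]≔_)
open import Data.Vec.Properties
  using (lookup-map; lookup∘update; lookup∘update′; []≔-lookup; []≔-idempotent)
import Data.Vec.Relation.Unary.All.Properties as VecAll
open import Function using (_∘_)
open import Function.Definitions using (Injective)
open import Level using (0ℓ)
open import Relation.Binary using (Rel; DecidableEquality)
open import Relation.Binary.Construct.Closure.ReflexiveTransitive using (Star; ε; _◅_)
open import Relation.Binary.PropositionalEquality
  using (_≡_; _≢_; refl; sym; trans; cong; cong₂; subst)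
open import Relation.Nullary using (¬_; yes; no; contradiction)
open import Relation.Unary using (Pred; Decidable; _∪_)

-- Derivations that count only their strong steps

module CountedRuns {X : Set} (S W : Rel X 0ℓ) where

  -- Weak steps leave the index unchanged. Unlike powers of the relative step, such runs are
  -- concatenated and moved into arguments one step at a time.
  data Run : ℕ → Rel X 0ℓ where
    done   : ∀ {s} → Run 0 s s
    weak   : ∀ {n s t u} → W s t → Run n t u → Run n s u
    strong : ∀ {n s t u} → S s t → Run n t u → Run (suc n) s u

  _/ʷ_ : Rel X 0ℓ
  s /ʷ t = ∃[ s′ ] ∃[ s″ ] (Star W s s′ × S s′ s″ × Star W s″ t)

  weak* : ∀ {n s t u} → Star W s t → Run n t u → Run n s u
  weak* ε        r = r
  weak* (w ◅ ws) r = weak w (weak* ws r)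

  -- Trailing weak steps are dropped: without a strong step after them they
  -- are not part of a relative step.
  run⇒pow : ∀ {n s t} → Run n s t → ∃[ t′ ] Pow _/ʷ_ n s t′
  run⇒pow done = _ , refl
  run⇒pow (weak {n = zero}  w r) = _ , refl
  run⇒pow (weak {n = suc _} w r) =
    let t′ , u , (s′ , s″ , ws , st , ws′) , p = run⇒pow r
    in  t′ , u , (s′ , s″ , w ◅ ws , st , ws′) , p
  run⇒pow (strong st r) =
    let t′ , p = run⇒pow r in t′ , _ , (_ , _ , ε , st , ε) , p

-- Positions, substitutions and steps below a function symbol

private
  variable
    Σ : Signature

lookup-·* : ∀ {n} (ts : Vec (Term Σ) n) (σ : Subst Σ) i →
            lookup (ts ·* σ) i ≡ lookup ts i · σ
lookup-·* (t ∷ ts) σ zero    = refl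
lookup-·* (t ∷ ts) σ (suc i) = lookup-·* ts σ i

infixl 20 _⊕_

_⊕_ : {t : Term Σ} (π : Pos t) → Pos (t ∣at π) → Pos t
here      ⊕ π′ = π′
there i π ⊕ π′ = there i (π ⊕ π′)

∣at-⊕ : {t : Term Σ} (π : Pos t) (π′ : Pos (t ∣at π)) →
        t ∣at (π ⊕ π′) ≡ (t ∣at π) ∣at π′
∣at-⊕ here        π′ = refl
∣at-⊕ (there i π) π′ = ∣at-⊕ π π′

⊕≢here : {t : Term Σ} (π : Pos t) (π′ : Pos (t ∣at π)) → π ≢ here → π ⊕ π′ ≢ here
⊕≢here here        π′ π≢here eq = π≢here refl
⊕≢here (there i π) π′ π≢here ()

module _ {C : Term Σ → Set} {P : RuleSet Σ} where

  step-arg : ∀ {f} {ts : Vec (Term Σ) (arity Σ f)} {u} i →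
             Step C P (lookup ts i) u → Step C P (fun f ts) (fun f (ts [ i ]≔ u))
  step-arg {f = f} {ts} i st = record
    { π = there i π ; ρ = ρ ; ρ∈P = ρ∈P ; σ = σ ; redex = redex ; allowed = allowed
    ; result = cong (λ u → fun f (ts [ i ]≔ u)) result }
    where open Step st

NF⇒irredex : {P : RuleSet Σ} {t : Term Σ} → NF P t → ∀ π → ¬ IsRedex P (t ∣at π)
NF⇒irredex nf π (ρ , σ , ρ∈P , eq) =
  nf (_ , record { π = π ; ρ = ρ ; ρ∈P = ρ∈P ; σ = σ ; redex = eq ; result = refl })

-- Runs carried out in separate arguments

module Arguments {Σ : Signature} (C : Term Σ → Set) (P Q : RuleSet Σ) where

  open CountedRuns (Step C P) (Step C Q)

  run-arg : ∀ {f} {ts : Vec (Term Σ) (arity Σ f)} {n s u} i → lookup ts i ≡ s →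
            Run n s u → Run n (fun f ts) (fun f (ts [ i ]≔ u))
  run-arg {f} {ts} i refl done =
    subst (λ us → Run 0 (fun f ts) (fun f us)) (sym ([]≔-lookup ts i)) done
  run-arg {f} {ts} {n} {u = u} i refl (weak {t = t} st r) =
    weak (step-arg i st)
         (subst (λ us → Run n _ (fun f us)) ([]≔-idempotent ts i)
                (run-arg i (lookup∘update i ts t) r))
  run-arg {f} {ts} {u = u} i refl (strong {n = n} {t = t} st r) =
    strong (step-arg i st)
           (subst (λ us → Run n _ (fun f us)) ([]≔-idempotent ts i)
                  (run-arg i (lookup∘update i ts t) r))

  _++ʳ_ : ∀ {m n s t u} → Run m s t → Run n t u → Run (m + n) s u
  done        ++ʳ r = r
  weak w q    ++ʳ r = weak w (q ++ʳ r)
  strong st q ++ʳ r = strong st (q ++ʳ r)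

  -- Injectivity of `ι` gives each run an argument of its own: updating one leaves the starting
  -- terms of the others untouched, and the counts add up.
  run-args : ∀ {c f} {ts : Vec (Term Σ) (arity Σ f)} {m : Fin c → ℕ}
             (ι : Fin c → Fin (arity Σ f)) → Injective _≡_ _≡_ ι →
             (∀ j → ∃[ u ] Run (m j) (lookup ts (ι j)) u) →
             ∃[ t ] Run (sum (tabulate m)) (fun f ts) t
  run-args {zero} ι inj runs = _ , done
  run-args {suc c} {f} {ts} {m} ι inj runs =
    let u , r  = runs zero
        t , r′ = run-args {ts = ts [ ι zero ]≔ u} (ι ∘ suc) (Fin.suc-injective ∘ inj)
                   (λ j → subst (λ s → ∃[ v ] Run (m (suc j)) s v)
                            (sym (lookup∘update′ (λ eq → Fin.0≢1+n (sym (inj eq))) ts u))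
                            (runs (suc j)))
    in  t , (run-arg (ι zero) refl r ++ʳ r′)

-- Finite bounds and counting in lists

bounded : ∀ {k} (f : Fin k → ℕ) → ∃[ d ] ∀ i → f i < d
bounded {zero}  f = 0 , λ ()
bounded {suc k} f with bounded (f ∘ suc)
... | d , f<d = suc (f zero) ⊔ d , λ where
  zero    → m≤m⊔n (suc (f zero)) d
  (suc i) → ≤-trans (f<d i) (m≤n⊔m (suc (f zero)) d)

-- The index of `e i` in `xs` determines `e i`, so it is injective in `i`.
injection⇒≤length : ∀ {X : Set} {k} (e : Fin k → X) → Injective _≡_ _≡_ e →
                    ∀ xs → (∀ i → e i ∈ xs) → k ≤ length xs
injection⇒≤length e inj xs e∈ = Fin.injective⇒≤ λ {i} {j} eq →
  inj (trans (lookup-index (e∈ i))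
        (trans (cong (List.lookup xs) eq) (sym (lookup-index (e∈ j)))))

module _ {X : Set} {A : Pred X 0ℓ} (A? : Decidable A) where

  -- Matches the count over a list of subtrees with the sum produced by `run-args`.
  length-filter-concat : ∀ {c} (g : Fin c → List X) →
    length (filter A? (concat (tabulate g))) ≡ sum (tabulate (length ∘ filter A? ∘ g))
  length-filter-concat {zero}  g = refl
  length-filter-concat {suc c} g =
    trans (cong length (filter-++ A? (g zero) (concat (tabulate (g ∘ suc)))))
      (trans (length-++ (filter A? (g zero)))
        (cong (length (filter A? (g zero)) +_) (length-filter-concat (g ∘ suc))))

-- Trees cut off at a finite depth

module Truncation {L : Set} (T : Tree L) where

  open Tree T

  nodes : ℕ → List ℕ → List (List ℕ)
  nodes zero    p = []
  nodes (suc d) p = p ∷ concat (tabulate λ i → nodes d (toℕ {#children p} i ∷ p))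

  -- `nodes` unfolds from the start of a path, while `Node` extends a path at its far end; this
  -- lemma reconciles the two recursions.
  ∈-nodes-child : ∀ d {p q} → q ∈ nodes d p → (i : Fin (#children q)) →
                  (toℕ i ∷ q) ∈ nodes (suc d) p
  ∈-nodes-child (suc d) {p} (here refl) i =
    there (∈-concat⁺′ (here refl) (∈-tabulate⁺ i))
  ∈-nodes-child (suc d) {p} {q} (there q∈) i with ∈-concat⁻′ _ q∈
  ... | ys , q∈ys , ys∈ with ∈-tabulate⁻ {f = λ i → nodes d (toℕ {#children p} i ∷ p)} ys∈
  ... | j , refl = there (∈-concat⁺′ (∈-nodes-child d q∈ys i) (∈-tabulate⁺ j))

  ∈-nodes : ∀ {d q} → Node q → length q < d → q ∈ nodes d []
  ∈-nodes top           (s≤s _)   = here refl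
  ∈-nodes (child nd i) (s≤s q<d) = ∈-nodes-child _ (∈-nodes nd q<d) i

-- Decidable equality and embedding of terms

module SharpTerms {F : FinSignature} (R : TRS F) where

  open Sharp R

  _≟ˢ_ : DecidableEquality Sym♯
  base f    ≟ˢ base g with f Fin.≟ g
  ... | yes refl = yes refl
  ... | no f≢g   = no λ { refl → f≢g refl }
  sharp f _ ≟ˢ sharp g _ with f Fin.≟ g
  ... | yes refl = yes refl
  ... | no f≢g   = no λ { refl → f≢g refl }
  com m     ≟ˢ com n with m ℕ.≟ n
  ... | yes refl = yes refl
  ... | no m≢n   = no λ { refl → m≢n refl }
  base _    ≟ˢ sharp _ _ = no λ ()
  base _    ≟ˢ com _     = no λ ()
  sharp _ _ ≟ˢ base _    = no λ ()
  sharp _ _ ≟ˢ com _     = no λ ()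
  com _     ≟ˢ base _    = no λ ()
  com _     ≟ˢ sharp _ _ = no λ ()

  _≟ᵗ_ : DecidableEquality (Term Σ♯)
  _≟ᵗ*_ : ∀ {n} → DecidableEquality (Vec (Term Σ♯) n)
  var x ≟ᵗ var y with x ℕ.≟ y
  ... | yes refl = yes refl
  ... | no x≢y   = no λ { refl → x≢y refl }
  var _ ≟ᵗ fun _ _ = no λ ()
  fun _ _ ≟ᵗ var _ = no λ ()
  fun f ts ≟ᵗ fun g us with f ≟ˢ g
  ... | no f≢g = no λ { refl → f≢g refl }
  ... | yes refl with ts ≟ᵗ* us
  ...   | yes refl = yes refl
  ...   | no ts≢us = no λ { refl → ts≢us refl }
  [] ≟ᵗ* [] = yes refl
  (t ∷ ts) ≟ᵗ* (u ∷ us) with t ≟ᵗ u | ts ≟ᵗ* us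
  ... | yes refl | yes refl = yes refl
  ... | no t≢u   | _        = no λ { refl → t≢u refl }
  ... | _        | no ts≢us = no λ { refl → ts≢us refl }

  -- Needed to decide, without excluded middle, whether a DT step is strong or weak.
  _≟ʳ_ : DecidableEquality (Rule Σ♯)
  (l ⇒ r) ≟ʳ (l′ ⇒ r′) with l ≟ᵗ l′ | r ≟ᵗ r′
  ... | yes refl | yes refl = yes refl
  ... | no l≢l′  | _        = no λ { refl → l≢l′ refl }
  ... | _        | no r≢r′  = no λ { refl → r≢r′ refl }

  lookup-embed* : ∀ {n} (ts : Vec (Term (sig F)) n) i →
                  lookup (embed* ts) i ≡ embed (lookup ts i)
  lookup-embed* (t ∷ ts) zero    = refl
  lookup-embed* (t ∷ ts) (suc i) = lookup-embed* ts i

  ∈V-embed⁺ : ∀ {x t} → x ∈V t → x ∈V embed t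
  ∈V-embed⁺ here = here
  ∈V-embed⁺ {x} (there {ts = ts} i x∈) =
    there i (subst (x ∈V_) (sym (lookup-embed* ts i)) (∈V-embed⁺ x∈))

  ∈V-embed⁻ : ∀ {x} t → x ∈V embed t → x ∈V t
  ∈V-embed⁻* : ∀ {x n} (ts : Vec (Term (sig F)) n) i →
               x ∈V lookup (embed* ts) i → x ∈V lookup ts i
  ∈V-embed⁻ (var x)    here         = here
  ∈V-embed⁻ (fun f ts) (there i x∈) = there i (∈V-embed⁻* ts i x∈)
  ∈V-embed⁻* (t ∷ ts) zero    x∈ = ∈V-embed⁻ t x∈
  ∈V-embed⁻* (t ∷ ts) (suc i) x∈ = ∈V-embed⁻* ts i x∈

  ∣embed∣ : ∀ t → ∣ embed t ∣ ≡ ∣ t ∣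
  ∣embed*∣ : ∀ {n} (ts : Vec (Term (sig F)) n) → ∣ embed* ts ∣* ≡ ∣ ts ∣*
  ∣embed∣ (var x)    = refl
  ∣embed∣ (fun f ts) = cong suc (∣embed*∣ ts)
  ∣embed*∣ []       = refl
  ∣embed*∣ (t ∷ ts) = cong₂ _+_ (∣embed∣ t) (∣embed*∣ ts)

  -- Plain terms and terms that are sharp only at the root

  ♯-defined : ∀ {f} ts (d : Defined ⟦ R ⟧ f) → fun f ts ♯ ≡ fun (sharp f d) (embed* ts)
  ♯-defined {f} ts d with defined? f
  ... | yes _ = refl
  ... | no ¬d = contradiction d ¬d

  -- The terms over Σ, as terms over Σ♯.
  data Plain : Term Σ♯ → Set where
    var : ∀ {x} → Plain (var x)
    fun : ∀ {f ts} → (∀ i → Plain (lookup ts i)) → Plain (fun (base f) ts)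

  data SharpPlain : Term Σ♯ → Set where
    fun : ∀ {f} .{d} {ts} → (∀ i → Plain (lookup ts i)) → SharpPlain (fun (sharp f d) ts)

  plain-·-var : ∀ {t x σ} → Plain (t · σ) → x ∈V t → Plain (σ x)
  plain-·-var pl here = pl
  plain-·-var {σ = σ} (fun pl) (there {ts = ts} i x∈) =
    plain-·-var (subst Plain (lookup-·* ts σ i) (pl i)) x∈

  plain-embed-· : ∀ {σ} t → (∀ x → x ∈V embed t → Plain (σ x)) → Plain (embed t · σ)
  plain-embed*-· : ∀ {σ n} (ts : Vec (Term (sig F)) n) →
    (∀ i x → x ∈V lookup (embed* ts) i → Plain (σ x)) →
    ∀ i → Plain (lookup (embed* ts ·* σ) i)
  plain-embed-· (var x)    pl = pl x here
  plain-embed-· (fun f ts) pl = fun (plain-embed*-· ts (λ i x x∈ → pl x (there i x∈)))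
  plain-embed*-· (t ∷ ts) pl zero    = plain-embed-· t (pl zero)
  plain-embed*-· (t ∷ ts) pl (suc i) = plain-embed*-· ts (pl ∘ suc) i

  plain-embed : ∀ t → Plain (embed t)
  plain-embed* : ∀ {n} (ts : Vec (Term (sig F)) n) i → Plain (lookup (embed* ts) i)
  plain-embed (var x)    = var
  plain-embed (fun f ts) = fun (plain-embed* ts)
  plain-embed* (t ∷ ts) zero    = plain-embed t
  plain-embed* (t ∷ ts) (suc i) = plain-embed* ts i

  sharpPlain-♯ : ∀ {t} → RootDefined t → SharpPlain (t ♯)
  sharpPlain-♯ {fun f ts} (.f , refl , d) rewrite ♯-defined ts d = fun (plain-embed* ts)

  sharpPlain-♯-· : ∀ {t σ} → RootDefined t → (∀ x → x ∈V (t ♯) → Plain (σ x)) →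
                   SharpPlain ((t ♯) · σ)
  sharpPlain-♯-· {fun f ts} (.f , refl , d) pl rewrite ♯-defined ts d =
    fun (plain-embed*-· ts (λ i x x∈ → pl x (there i x∈)))

  sharpPlain-·-var : ∀ {t x σ} → RootDefined t → SharpPlain ((t ♯) · σ) →
                     x ∈V (t ♯) → Plain (σ x)
  sharpPlain-·-var {fun f ts} {σ = σ} (.f , refl , d) sp x∈ rewrite ♯-defined ts d
    with sp | x∈
  ... | fun pl | there i x∈i = plain-·-var (subst Plain (lookup-·* (embed* ts) σ i) (pl i)) x∈i

  ¬plain-♯-· : ∀ {t σ} → RootDefined t → ¬ Plain ((t ♯) · σ)
  ¬plain-♯-· {fun f ts} (.f , refl , d) pl rewrite ♯-defined ts d with pl
  ... | ()

  plain-∣at : ∀ {t} → Plain t → (π : Pos t) → Plain (t ∣at π)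
  plain-∣at pl       here        = pl
  plain-∣at (fun pl) (there i π) = plain-∣at (pl i) π

  sharpPlain-∣at : ∀ {t} → SharpPlain t → (π : Pos t) → π ≢ here → Plain (t ∣at π)
  sharpPlain-∣at sp       here        π≢here = contradiction refl π≢here
  sharpPlain-∣at (fun pl) (there i π) _      = plain-∣at (pl i) π

  plain-update : ∀ {n} {ts : Vec (Term Σ♯) n} {u} i → (∀ j → Plain (lookup ts j)) →
                 Plain u → ∀ j → Plain (lookup (ts [ i ]≔ u) j)
  plain-update {ts = ts} {u} i pl pu j with j Fin.≟ i
  ... | yes refl = subst Plain (sym (lookup∘update i ts u)) pu
  ... | no j≢i   = subst Plain (sym (lookup∘update′ j≢i ts u)) (pl j)

  plain-[]at : ∀ {t u} → Plain t → Plain u → (π : Pos t) → Plain (t [ u ]at π)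
  plain-[]at pl       pu here        = pu
  plain-[]at (fun {ts = ts} pl) pu (there i π) =
    fun (plain-update {ts = ts} i pl (plain-[]at (pl i) pu π))

  sharpPlain-[]at : ∀ {t u} → SharpPlain t → Plain u → (π : Pos t) → π ≢ here →
                    SharpPlain (t [ u ]at π)
  sharpPlain-[]at sp       pu here        π≢here = contradiction refl π≢here
  sharpPlain-[]at (fun {ts = ts} pl) pu (there i π) _ =
    fun (plain-update {ts = ts} i pl (plain-[]at (pl i) pu π))

  -- Every variable of the right-hand side occurs on the left, where its image is a subterm of a
  -- plain term.
  plain-contractum : ∀ {ρ σ} → R♯ ρ → Plain (lhs ρ · σ) → Plain (rhs ρ · σ)
  plain-contractum ρ∈R♯ pl with ∈-map⁻ embedRule ρ∈R♯
  ... | (l ⇒ r) , ρ∈R , refl = plain-embed-· r λ x x∈ →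
    plain-·-var pl
      (∈V-embed⁺ (proj₂ (All.lookup (isRules R) ρ∈R) x (∈V-embed⁻ r x∈)))

  -- Left-hand sides of R are not variables, so the root of a redex is an unsharped symbol.
  ¬sharpPlain-R♯-redex : ∀ {t} → SharpPlain t → ¬ IsRedex R♯ t
  ¬sharpPlain-R♯-redex sp (ρ , σ , ρ∈R♯ , eq) with ∈-map⁻ embedRule ρ∈R♯
  ... | (var x ⇒ r)    , ρ∈R , refl = proj₁ (All.lookup (isRules R) ρ∈R) x refl
  ... | (fun f ts ⇒ r) , ρ∈R , refl with subst SharpPlain eq sp
  ... | ()

  root-embed-R♯ : ∀ {g} → Defined R♯ (base g) → Defined ⟦ R ⟧ g
  root-embed-R♯ (ρ , ρ∈R♯ , eq) with ∈-map⁻ embedRule ρ∈R♯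
  ... | (var x ⇒ r) , _ , refl = contradiction eq λ ()
  ... | (fun f ts ⇒ r) , ρ∈R , refl with eq
  ... | refl = _ , ρ∈R , refl

  module _ {C : Term Σ♯ → Set} {s t : Term Σ♯} (sp : SharpPlain s) (st : Step C R♯ s t) where

    open Step st

    R♯-position≢here : π ≢ here
    R♯-position≢here eq = ¬sharpPlain-R♯-redex sp
      (ρ , σ , ρ∈P , trans (cong (s ∣at_) (sym eq)) redex)

    plain-R♯-redex : Plain (lhs ρ · σ)
    plain-R♯-redex = subst Plain redex (sharpPlain-∣at sp π R♯-position≢here)

    sharpPlain-R♯-step : SharpPlain t
    sharpPlain-R♯-step = subst SharpPlain (sym result)
      (sharpPlain-[]at sp (plain-contractum ρ∈P plain-R♯-redex) π R♯-position≢here)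

-- Innermost steps of the relative system

module Simulation {F : FinSignature} (P : DTProblem F) where

  open Problem P
  open SharpTerms R

  full : RuleSet Σ♯
  full = ⟦ S ⟧ᴰ ∪ weak

  Innermost : Term Σ♯ → Set
  Innermost u = ∀ v → v ProperSubtermOf u → NF full v

  open CountedRuns (Step Innermost ⟦ S ⟧ᴰ) (Step Innermost weak)
    using (Run; done; strong; weak*; run⇒pow) renaming (weak to weakly)
  open Arguments Innermost ⟦ S ⟧ᴰ weak using (run-args)

  strongRule? : Decidable ⟦ S ⟧ᴰ
  strongRule? ρ = any? (ρ ≟ʳ_) (map rule S)

  rootDefined : ∀ {d} → d ∈ D → RootDefined (source d)
  rootDefined d∈D = proj₁ (All.lookup isDTs d∈D)

  full-rule : ∀ {ρ} → full ρ → (∃[ d ] (d ∈ D × ρ ≡ rule d)) ⊎ R♯ ρ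
  full-rule (inj₁ ρ∈S) with ∈-map⁻ rule ρ∈S
  ... | d , d∈S , eq = inj₁ (d , S⊆D d∈S , eq)
  full-rule (inj₂ (inj₁ (ρ∈D , _))) = inj₁ (∈-map⁻ rule ρ∈D)
  full-rule (inj₂ (inj₂ ρ∈R♯)) = inj₂ ρ∈R♯

  rule∈full : ∀ {d} → d ∈ D → full (rule d)
  rule∈full {d} d∈D with strongRule? (rule d)
  ... | yes ρ∈S = inj₁ ρ∈S
  ... | no ρ∉S  = inj₂ (inj₁ (∈-map⁺ rule d∈D , ρ∉S))

  -- A DT redex has a sharp root, so it cannot occur in a plain term.
  plain-NF : ∀ {t} → Plain t → (∀ π → ¬ IsRedex R♯ (t ∣at π)) → NF full t
  plain-NF {t} pl irr (_ , st) with full-rule (Step.ρ∈P st)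
  ... | inj₁ (d , d∈D , refl) =
    ¬plain-♯-· (rootDefined d∈D) (subst Plain (Step.redex st) (plain-∣at pl (Step.π st)))
  ... | inj₂ ρ∈R♯ = irr (Step.π st) (Step.ρ st , Step.σ st , ρ∈R♯ , Step.redex st)

  -- Innermost steps of R only exclude R-redexes as proper subterms, whereas the relative system
  -- asks for normal forms under all rules; plainness closes the gap.
  innermost : ∀ {u} → (∀ π → π ≢ here → Plain (u ∣at π) × ¬ IsRedex R♯ (u ∣at π)) →
              Innermost u
  innermost {u} below _ (π , π≢here , refl) =
    plain-NF (proj₁ (below π π≢here)) λ π′ red →
      -- Each subterm of a proper subterm is itself proper, so `below` covers it.
      proj₂ (below (π ⊕ π′) (⊕≢here π π′ π≢here))
            (subst (IsRedex R♯) (sym (∣at-⊕ π π′)) red)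

  -- The redex lies strictly below the sharp root, hence is plain together with all its subterms.
  weak-R♯-step : ∀ {s t} → SharpPlain s → R♯ ⊢ s ⟶ⁱ t → Step Innermost weak s t
  weak-R♯-step sp st = record
    { π = π ; ρ = ρ ; ρ∈P = inj₂ ρ∈P ; σ = σ ; redex = redex ; result = result
    ; allowed = innermost λ π′ π′≢here →
        plain-∣at (plain-R♯-redex sp st) π′ , allowed _ (π′ , π′≢here , refl) }
    where open Step st

  weak-R♯-steps : ∀ {s t} → SharpPlain s → R♯ ⊢ s ⟶ⁱ* t →
                  Star (Step Innermost weak) s t × SharpPlain t
  weak-R♯-steps sp ε          = ε , sp
  weak-R♯-steps sp (st ◅ sts) =
    let ws , sp′ = weak-R♯-steps (sharpPlain-R♯-step sp st) sts
    in  weak-R♯-step sp st ◅ ws , sp′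

  -- This is where the normal form condition on the nodes of a chain tree enters.
  dt-innermost : ∀ {t} → SharpPlain t → NF R♯ t → Innermost t
  dt-innermost sp nf = innermost λ π π≢here →
    sharpPlain-∣at sp π π≢here , NF⇒irredex nf π

  -- The variables of a target occur in the compound right-hand side, hence in the source, whose
  -- instance forces their images to be plain.
  sharpPlain-target : ∀ {d σ} → d ∈ D → SharpPlain (source♯ d · σ) →
                      ∀ i → SharpPlain (target♯ d i · σ)
  sharpPlain-target {d} d∈D sp i with All.lookup isDTs d∈D
  ... | src , tgts , _ , vars = sharpPlain-♯-· (VecAll.lookup⁺ tgts i) λ x x∈ →
    sharpPlain-·-var src sp
      (vars x (there i (subst (x ∈V_) (sym (lookup-map i _♯ (targets d))) x∈)))

  -- Replay of a truncated chain tree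

  module _ (T : Tree Label) {s : Term Σ♯} (chain : IsChainTreeFor T s) (sp : SharpPlain s) where

    open Tree T using (Node; child; top; #children)
    open IsChainTreeFor chain
    open Truncation T

    -- The relative system sees rules rather than DTs, so the rule is tested. No S-node is lost,
    -- since a DT in S has its rule among those of S.
    strongNode? : Decidable (λ p → ⟦ S ⟧ᴰ (rule (dt T p)))
    strongNode? p = strongRule? (rule (dt T p))

    private
      count : List (List ℕ) → ℕ
      count ps = length (filter strongNode? ps)

      term : List ℕ → Term Σ♯
      term p = source♯ (dt T p) · sub T p

    -- The induction is on the depth `d`, because the tree may be infinite. The final term stays
    -- unspecified, as only the number of strong steps matters.
    simulate : ∀ d {p} → Node p → SharpPlain (term p) →
               ∃[ t ] Run (count (nodes d p)) (term p) t
    simulate zero    nd spp = _ , done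
    simulate (suc d) {p} nd spp = result
      where
      δ = dt T p
      σ = sub T p
      ι = proj₁ (children nd)

      subtree : Fin (#children p) → List (List ℕ)
      subtree i = nodes d (toℕ i ∷ p)

      subtrees = concat (tabulate subtree)

      subrun : ∀ j → ∃[ u ] Run (count (subtree j))
                                (lookup (Vec.map _♯ (targets δ) ·* σ) (ι j)) u
      subrun j =
        -- Inside its argument of the compound symbol, the target is first reduced by R to the term
        -- of the child; these steps are weak.
        let ws , spj = weak-R♯-steps (sharpPlain-target (labels nd) spp (ι j))
                                     (proj₂ (proj₂ (children nd)) j)
            u , r    = simulate d (child nd j) spj
        in  u , subst (λ v → Run _ v u)
                  (sym (trans (lookup-·* (Vec.map _♯ (targets δ)) σ (ι j))
                              (cong (_· σ) (lookup-map (ι j) _♯ (targets δ)))))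
                  (weak* ws r)

      subruns : ∃[ t ] Run (count subtrees) (rhs (rule δ) · σ) t
      subruns = subst (λ n → ∃[ t ] Run n (rhs (rule δ) · σ) t)
                  (sym (length-filter-concat strongNode? subtree))
                  (run-args ι (proj₁ (proj₂ (children nd))) subrun)

      dt-step : ∀ {Q} → Q (rule δ) → Step Innermost Q (term p) (rhs (rule δ) · σ)
      dt-step ρ∈Q = record
        { π = here ; ρ = rule δ ; ρ∈P = ρ∈Q ; σ = σ ; redex = refl ; result = refl
        ; allowed = dt-innermost spp (normal nd) }

      result : ∃[ t ] Run (count (p ∷ subtrees)) (term p) t
      result with strongNode? p
      ... | yes ρ∈S = _ , strong (dt-step ρ∈S) (proj₂ subruns)
      -- The DT is in D but its rule is not a rule of S: the step is weak, and the filter skips `p`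
      -- accordingly.
      ... | no ρ∉S  = _ , weakly (dt-step (inj₁ (∈-map⁺ rule (labels nd) , ρ∉S))) (proj₂ subruns)

    sizeS≤dh : sizeS T ≤ω dh s (relativeStep ⟦ S ⟧ᴰ weak)
    sizeS≤dh k (inj₁ k≡0) = inj₁ k≡0
    sizeS≤dh k (inj₂ ((m , e , e-inj , e∈) , k≤m)) =
      -- Finitely many paths are given, so some `d` exceeds all their lengths. The bound is strict
      -- because `nodes d []` stops before length `d`.
      let d , e<d = bounded (length ∘ e)
          t , run = simulate d top (subst SharpPlain (sym start) sp)
          t′ , p  = run⇒pow run
      in  inj₂ ( (_ , t′ , subst (λ u → Pow _ (count (nodes d [])) u t′) start p)
               , ≤-trans k≤m (injection⇒≤length e e-inj _ λ i →
                   ∈-filter⁺ strongNode? (∈-nodes (proj₁ (e∈ i)) (e<d i))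
                                         (∈-map⁺ rule (proj₂ (e∈ i)))))

  -- Basic terms and the two complexity bounds

  basic-sharpPlain : ∀ {t} → Basic ⟦ R ⟧ t → SharpPlain (t ♯)
  basic-sharpPlain (basic d _) = sharpPlain-♯ (_ , refl , d)

  Cplx≤dh : ∀ {t} → Basic ⟦ R ⟧ t → Cplx (t ♯) ≤ω dh (t ♯) (relativeStep ⟦ S ⟧ᴰ weak)
  Cplx≤dh {t} b = sup-least (λ (T , _) → sizeS T) (dh (t ♯) _)
    λ (T , chain) → sizeS≤dh T chain (basic-sharpPlain b)

  ∣♯∣ : ∀ {t} → Basic ⟦ R ⟧ t → ∣ t ♯ ∣ ≡ ∣ t ∣
  ∣♯∣ (basic {ts = ts} d _) rewrite ♯-defined ts d = cong suc (∣embed*∣ ts)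

  -- The source is not a variable, so instantiation keeps its root.
  root-source♯ : ∀ {d σ f} .{df : Defined ⟦ R ⟧ f} {ts} → RootDefined (source d) →
                 source♯ d · σ ≡ fun (sharp f df) ts → root (source♯ d) ≡ just (sharp f df)
  root-source♯ {d} rd eq with source d
  root-source♯ (_ , refl , dg) eq | fun g us rewrite ♯-defined us dg = cong root eq

  ¬base-root-♯ : ∀ {t g} → RootDefined t → root (t ♯) ≢ just (base g)
  ¬base-root-♯ {fun f ts} (.f , refl , d) eq rewrite ♯-defined ts d with eq
  ... | ()

  -- DTs define only sharp symbols, so constructors of R remain constructors of the whole system.
  defined-full-base : ∀ {g} → Defined full (base g) → Defined ⟦ R ⟧ g
  defined-full-base (ρ , ρ∈ , eq) with full-rule ρ∈
  ... | inj₁ (d , d∈D , refl) = contradiction eq (¬base-root-♯ (rootDefined d∈D))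
  ... | inj₂ ρ∈R♯ = root-embed-R♯ (ρ , ρ∈R♯ , eq)

  constructor-embed : ∀ {t} → ConstructorTerm ⟦ R ⟧ t → ConstructorTerm full (embed t)
  constructor-embed (var x) = var x
  constructor-embed (fun {ts = ts} ¬d cs) = fun (¬d ∘ defined-full-base) λ i →
    subst (ConstructorTerm full) (sym (lookup-embed* ts i)) (constructor-embed (cs i))

  -- Without a chain tree, f♯ need not be the root of any left-hand side.
  basic-♯ : ∀ {t T} → Basic ⟦ R ⟧ t → IsChainTreeFor T (t ♯) → Basic full (t ♯)
  basic-♯ {T = T} (basic {ts = ts} d cs) chain rewrite ♯-defined ts d =
    basic (_ , rule∈full root∈D , root≡) λ i →
      subst (ConstructorTerm full) (sym (lookup-embed* ts i)) (constructor-embed (cs i))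
    where
    open IsChainTreeFor chain
    root∈D = labels Tree.top
    root≡  = root-source♯ {d = dt T []} {σ = sub T []} (rootDefined root∈D) start

  ircDT≤irc : ∀ n → ircDT n ≤ω ircRelative ⟦ S ⟧ᴰ weak n
  ircDT≤irc n k (inj₁ k≡0) = inj₁ k≡0
  -- The default value 0 of `Cplx` covers terms without a chain tree, whose sharp versions may fail
  -- to be basic.
  ircDT≤irc n k (inj₂ (_ , inj₁ k≡0)) = inj₁ k≡0
  ircDT≤irc n k (inj₂ ((t , b , ∣t∣≤n) , inj₂ ((T , chain) , k≤))) =
    inj₂ ( (t ♯ , basic-♯ {T = T} b chain , ≤-trans (≤-reflexive (∣♯∣ b)) ∣t∣≤n)
         , sizeS≤dh T chain (basic-sharpPlain b) k k≤ )

theorem5p6 : (F : FinSignature) (P : DTProblem F) →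
    let open Problem P in
    ((t : Term (sig F)) → Basic ⟦ R ⟧ t →
    Cplx (t ♯) ≤ω dh (t ♯) (relativeStep ⟦ S ⟧ᴰ weak))
    × ((n : ℕ) → ircDT n ≤ω ircRelative ⟦ S ⟧ᴰ weak n)
theorem5p6 F P = (λ t b → Cplx≤dh b) , ircDT≤irc
  where open Simulation P
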